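{- The following hold, where ${?}\Gamma^{\mathsf T}$ assigns ${?}(B^{\mathsf T})$ to $x$ for each $x:B$ in $\Gamma$, $(\Theta^{\mathsf T})^\perp$ assigns $(B^{\mathsf T})^\perp$ to $\gamma$ for each $\gamma:B$ in $\Theta$, and the linear environment is empty: 1. If $c:(\Gamma\vdash\Theta)$ is derivable in $\overline\lambda\mu\tilde\mu$, then ${?}\Gamma^{\mathsf T},(\Theta^{\mathsf T})^\perp;\cdot\vdash c^{\mathsf T}:\bot$ is derivable in $\lambda_{\mathrm{MELL}}$. 2. If $\Gamma\mid e:A\vdash\Theta$ is derivable in $\overline\lambda\mu\tilde\mu$, then ${?}\Gamma^{\mathsf T},(\Theta^{\mathsf T})^\perp;\cdot\vdash e^{\mathsf T}:{!}((A^{\mathsf T})^\perp)$ is derivable in $\lambda_{\mathrm{MELL}}$. 3. If $\Gamma\vdash v:A\mid\Theta$ is derivable in $\overline\lambda\mu\tilde\mu$, then ${?}\Gamma^{\mathsf T},(\Theta^{\mathsf T})^\perp;\cdot\vdash v^{\mathsf T}:{?}A^{\mathsf T}$ is derivable in $\lambda_{\mathrm{MELL}}$.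
   Context: The calculus $\overline\lambda\mu\tilde\mu$ (as considered here). Types: $A,B::=\alpha\mid A\supset B$ ($\alpha$ atomic). Terms $v::=x\mid\mu\gamma.c\mid\lambda x.v$; co-terms $e::=\gamma\mid v\cdot e$; commands $c::=\langle v\mid e\rangle$; $x$ ranges over variables and $\gamma$ over co-variables. $\Gamma$ assigns types to variables and $\Theta$ assigns types to co-variables. Rules (premises $\Rightarrow$ conclusion): $\Rightarrow\Gamma,x:A\vdash x:A\mid\Theta$; $\Rightarrow\Gamma\mid\gamma:A\vdash\gamma:A,\Theta$; $\Gamma\vdash v:A\mid\Theta$ and $\Gamma\mid e:B\vdash\Theta$ $\Rightarrow$ $\Gamma\mid(v\cdot e):A\supset B\vdash\Theta$; $c:(\Gamma\vdash\gamma:B,\Theta)$ $\Rightarrow$ $\Gamma\vdash\mu\gamma.c:B\mid\Theta$; $\Gamma,x:A\vdash v:B\mid\Theta$ $\Rightarrow$ $\Gamma\vdash\lambda x.v:A\supset B\mid\Theta$; $\Gamma\vdash v:A\mid\Theta$ and $\Gamma\mid e:A\vdash\Theta$ $\Rightarrow$ $\langle v\mid e\rangle:(\Gamma\vdash\Theta)$. MELL formulae: $A,B::=\alpha\mid\overline\alpha\mid A\otimes B\mid A\wp B\mid\mathbf 1\mid\bot\mid{!}A\mid{?}A$ ($\wp$ is "par"). Linear negation is the involution $\alpha^\perp=\overline\alpha$, $\overline\alpha^\perp=\alpha$, $(A\otimes B)^\perp=A^\perp\wp B^\perp$, $(A\wp B)^\perp=A^\perp\otimes B^\perp$, $\mathbf1^\perp=\bot$,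 $\bot^\perp=\mathbf1$, $({!}A)^\perp={?}(A^\perp)$, $({?}A)^\perp={!}(A^\perp)$. Terms of $\lambda_{\mathrm{MELL}}$, over linear variables $a,b,c,\dots$ and unrestricted variables $u,v,\dots$: $t,s::=a\mid u\mid\langle t,s\rangle\mid t[\langle a,b\rangle:=s]\mid\wp(a,b).t\mid t\bullet s\mid t\blacktriangledown s\mid{!}a.t\mid t[{!}u:=s]\mid{?}u.t\mid t\blacktriangleright^{a}s\mid t\,\sharp\,s\mid\star\mid t[\star:=s]$. Binding: $t[\langle a,b\rangle:=s]$ and $\wp(a,b).t$ bind $a,b$ in $t$; ${!}a.t$ and $t\blacktriangleright^a s$ bind $a$ in $t$; $t[{!}u:=s]$ and ${?}u.t$ bind $u$ in $t$. Terms are taken up to $\alpha$-renaming. Typing judgements $\Delta;\Gamma\vdash t:A$, where $\Delta$ (resp. $\Gamma$) is a finite partial function from unrestricted (resp. linear) variables to formulae; $\Gamma,\Gamma'$ denotes union with disjoint domains. Typing rules: $\Rightarrow\Delta;a:A\vdash a:A$; $\Rightarrow\Delta,u:A;\cdot\vdash u:A$; $\Delta;\Gamma\vdash t:A$ and $\Delta;\Gamma'\vdash s:B$ $\Rightarrow$ $\Delta;\Gamma,\Gamma'\vdash\langle t,s\rangle:A\otimes B$; $\Delta;\Gamma\vdash s:A\otimes B$ and $\Delta;\Gamma',a:A,b:B\vdash t:C$ $\Rightarrow$ $\Delta;\Gamma,\Gamma'\vdash t[\langle a,b\rangle:=s]:C$; $\Delta;\Gamma,a:A,b:B\vdash t:\bot$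 $\Rightarrow$ $\Delta;\Gamma\vdash\wp(a,b).t:A^\perp\wp B^\perp$; $\Delta;\Gamma\vdash t:A\wp B$ and $\Delta;\Gamma'\vdash s:A^\perp$ $\Rightarrow$ $\Delta;\Gamma,\Gamma'\vdash t\bullet s:B$; $\Delta;\Gamma\vdash t:A\wp B$ and $\Delta;\Gamma'\vdash s:B^\perp$ $\Rightarrow$ $\Delta;\Gamma,\Gamma'\vdash t\blacktriangledown s:A$; $\Delta;a:A\vdash t:\bot$ $\Rightarrow$ $\Delta;\cdot\vdash{!}a.t:{!}(A^\perp)$; $\Delta;\Gamma\vdash s:{!}A$ and $\Delta,u:A;\Gamma'\vdash t:B$ $\Rightarrow$ $\Delta;\Gamma,\Gamma'\vdash t[{!}u:=s]:B$; $\Delta,u:A^\perp;\Gamma\vdash t:\bot$ $\Rightarrow$ $\Delta;\Gamma\vdash{?}u.t:{?}A$; $\Delta;\Gamma\vdash s:{?}A$ and $\Delta;a:A\vdash t:\bot$ $\Rightarrow$ $\Delta;\Gamma\vdash t\blacktriangleright^a s:\bot$; $\Delta;\Gamma\vdash t:B$ and $\Delta;\Gamma'\vdash s:B^\perp$ $\Rightarrow$ $\Delta;\Gamma,\Gamma'\vdash t\,\sharp\,s:\bot$; $\Rightarrow\Delta;\cdot\vdash\star:\mathbf1$; $\Delta;\Gamma\vdash s:\mathbf1$ and $\Delta;\Gamma'\vdash t:A$ $\Rightarrow$ $\Delta;\Gamma,\Gamma'\vdash t[\star:=s]:A$. T-translation. Write ${!}t:={!}a.(t\,\sharp\,a)$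 with $a$ fresh. On types: $\alpha^{\mathsf T}=\alpha$, $(A\supset B)^{\mathsf T}={?}{!}(A^{\mathsf T})^\perp\wp{?}B^{\mathsf T}$. Variables and co-variables are regarded as unrestricted variables. On expressions (with $u$ unrestricted and $a,b$ linear, fresh): $x^{\mathsf T}=x$; $(\mu\gamma.c)^{\mathsf T}={?}\gamma.c^{\mathsf T}$; $(\lambda x.v)^{\mathsf T}={?}u.(u\,\sharp\,\wp(a,b).((v^{\mathsf T}\,\sharp\,b)[{!}x:=a]))$; $\gamma^{\mathsf T}={!}\gamma$; $(v\cdot e)^{\mathsf T}={!}\langle{!}v^{\mathsf T},e^{\mathsf T}\rangle$; $\langle v\mid e\rangle^{\mathsf T}=v^{\mathsf T}\,\sharp\,e^{\mathsf T}$. -}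

module Defs where

open import Data.Fin.Base using (Fin; zero; suc; lift; _↑ˡ_; _↑ʳ_)
open import Data.Maybe.Base using (Maybe; just; nothing)
open import Data.Nat.Base using (ℕ; suc; _+_)
open import Data.Vec.Base using (Vec; []; _∷_; map; _++_; replicate; _[_]=_; _[_]≔_)
open import Data.Vec.Functional using () renaming (_∷_ to _∷ᶠ_)
open import Function.Base using (_∘′_)

private variable
  Atom : Set
  k k′ l l′ m n : ℕ

infixr 7 _⊃_

data Type (Atom : Set) : Set where
  atom : Atom → Type Atom
  _⊃_  : Type Atom → Type Atom → Type Atom

-- λ̄μμ̃-expressions up to α-renaming, as well-scoped de Bruijn syntax: m is the
-- number of variables in scope, n the number of co-variables.

infixr 6 _·_

mutual
  data Term (m n : ℕ) : Set where
    var : Fin m → Term m n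
    μ·_ : Command m (suc n) → Term m n
    ƛ·_ : Term (suc m) n → Term m n

  data Coterm (m n : ℕ) : Set where
    covar : Fin n → Coterm m n
    _·_   : Term m n → Coterm m n → Coterm m n

  data Command (m n : ℕ) : Set where
    ⟨_∣_⟩ : Term m n → Coterm m n → Command m n

infix 4 _⊢_∶_∣_ _∣_∶_⊢_ _∶⟨_⊢_⟩

mutual
  data _⊢_∶_∣_ {Atom : Set} {m n : ℕ}
    (Γ : Vec (Type Atom) m) : Term m n → Type Atom → Vec (Type Atom) n → Set where

    var : ∀ {Θ x A} →
          Γ [ x ]= A →
          Γ ⊢ var x ∶ A ∣ Θ

    mu  : ∀ {Θ c B} →
          c ∶⟨ Γ ⊢ B ∷ Θ ⟩ →
          Γ ⊢ μ· c ∶ B ∣ Θ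

    lam : ∀ {Θ v A B} →
          A ∷ Γ ⊢ v ∶ B ∣ Θ →
          Γ ⊢ ƛ· v ∶ A ⊃ B ∣ Θ

  data _∣_∶_⊢_ {Atom : Set} {m n : ℕ}
    (Γ : Vec (Type Atom) m) : Coterm m n → Type Atom → Vec (Type Atom) n → Set where

    covar : ∀ {Θ γ A} →
            Θ [ γ ]= A →
            Γ ∣ covar γ ∶ A ⊢ Θ

    app   : ∀ {Θ v e A B} →
            Γ ⊢ v ∶ A ∣ Θ →
            Γ ∣ e ∶ B ⊢ Θ →
            Γ ∣ v · e ∶ A ⊃ B ⊢ Θ

  data _∶⟨_⊢_⟩ {Atom : Set} {m n : ℕ} :
    Command m n → Vec (Type Atom) m → Vec (Type Atom) n → Set where

    cut : ∀ {Γ Θ v e A} →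
          Γ ⊢ v ∶ A ∣ Θ →
          Γ ∣ e ∶ A ⊢ Θ →
          ⟨ v ∣ e ⟩ ∶⟨ Γ ⊢ Θ ⟩

-- The exponential "why not" is written ⁇, since ? is reserved by Agda.

infix  9 !_ ⁇_
infixr 8 _⊗_
infixr 7 _⅋_

data Formula (Atom : Set) : Set where
  atom   : Atom → Formula Atom
  coatom : Atom → Formula Atom
  _⊗_    : Formula Atom → Formula Atom → Formula Atom
  _⅋_    : Formula Atom → Formula Atom → Formula Atom
  𝟙      : Formula Atom
  ⊥      : Formula Atom
  !_     : Formula Atom → Formula Atom
  ⁇_     : Formula Atom → Formula Atom

infix 10 _^⊥

_^⊥ : Formula Atom → Formula Atom
(atom α)   ^⊥ = coatom α
(coatom α) ^⊥ = atom α
(A ⊗ B)    ^⊥ = A ^⊥ ⅋ B ^⊥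
(A ⅋ B)    ^⊥ = A ^⊥ ⊗ B ^⊥
𝟙          ^⊥ = ⊥
⊥          ^⊥ = 𝟙
(! A)      ^⊥ = ⁇ (A ^⊥)
(⁇ A)      ^⊥ = ! (A ^⊥)

-- λ_MELL-terms up to α-renaming: k unrestricted and l linear variables are in scope.  When a construct
-- binds two linear variables a, b, index 0 stands for a and index 1 for b.

infixl 7 _∙_ _▾_
infix  6 _♯_ _▸_

data LTerm (k l : ℕ) : Set where
  lin      : Fin l → LTerm k l                              -- a
  unr      : Fin k → LTerm k l                              -- u
  ⟨_,_⟩    : LTerm k l → LTerm k l → LTerm k l              -- ⟨t,s⟩
  _[⟨,⟩≔_] : LTerm k (2 + l) → LTerm k l → LTerm k l        -- t[⟨a,b⟩:=s]
  ⅋·_      : LTerm k (2 + l) → LTerm k l                    -- ⅋(a,b).t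
  _∙_      : LTerm k l → LTerm k l → LTerm k l              -- t ∙ s
  _▾_      : LTerm k l → LTerm k l → LTerm k l              -- t ▾ s
  !·_      : LTerm k (1 + l) → LTerm k l                    -- !a.t
  _[!≔_]   : LTerm (1 + k) l → LTerm k l → LTerm k l        -- t[!u:=s]
  ⁇·_      : LTerm (1 + k) l → LTerm k l                    -- ?u.t
  _▸_      : LTerm k (1 + l) → LTerm k l → LTerm k l        -- t ▸ᵃ s
  _♯_      : LTerm k l → LTerm k l → LTerm k l              -- t ♯ s
  ⋆        : LTerm k l
  _[⋆≔_]   : LTerm k l → LTerm k l → LTerm k l              -- t[⋆:=s]

rename : (Fin k → Fin k′) → (Fin l → Fin l′) → LTerm k l → LTerm k′ l′
rename ρ σ (lin a)       = lin (σ a)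
rename ρ σ (unr u)       = unr (ρ u)
rename ρ σ ⟨ t , s ⟩     = ⟨ rename ρ σ t , rename ρ σ s ⟩
rename ρ σ (t [⟨,⟩≔ s ]) = rename ρ (lift 2 σ) t [⟨,⟩≔ rename ρ σ s ]
rename ρ σ (⅋· t)        = ⅋· rename ρ (lift 2 σ) t
rename ρ σ (t ∙ s)       = rename ρ σ t ∙ rename ρ σ s
rename ρ σ (t ▾ s)       = rename ρ σ t ▾ rename ρ σ s
rename ρ σ (!· t)        = !· rename ρ (lift 1 σ) t
rename ρ σ (t [!≔ s ])   = rename (lift 1 ρ) σ t [!≔ rename ρ σ s ]
rename ρ σ (⁇· t)        = ⁇· rename (lift 1 ρ) σ t
rename ρ σ (t ▸ s)       = rename ρ (lift 1 σ) t ▸ rename ρ σ s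
rename ρ σ (t ♯ s)       = rename ρ σ t ♯ rename ρ σ s
rename ρ σ ⋆             = ⋆
rename ρ σ (t [⋆≔ s ])   = rename ρ σ t [⋆≔ rename ρ σ s ]

-- A linear environment is a partial function from the l linear variables in
-- scope to formulae.  An unrestricted environment may be taken total on the
-- variables in scope, because the typing rules never remove its entries.

LinEnv : Set → ℕ → Set
LinEnv Atom l = Vec (Maybe (Formula Atom)) l

UnrEnv : Set → ℕ → Set
UnrEnv Atom k = Vec (Formula Atom) k

∅ : LinEnv Atom l
∅ = replicate _ nothing

-- Γ ≋ Γ₁ ⊎ Γ₂: the domains of Γ₁ and Γ₂ are disjoint and Γ is their union.

infix 4 _≋_⊎_

data _≋_⊎_ {Atom : Set} : LinEnv Atom l → LinEnv Atom l → LinEnv Atom l → Set where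
  []    : [] ≋ [] ⊎ []
  skip  : ∀ {Γ Γ₁ Γ₂ : LinEnv Atom l} → Γ ≋ Γ₁ ⊎ Γ₂ →
          nothing ∷ Γ ≋ nothing ∷ Γ₁ ⊎ nothing ∷ Γ₂
  left  : ∀ {A} {Γ Γ₁ Γ₂ : LinEnv Atom l} → Γ ≋ Γ₁ ⊎ Γ₂ →
          just A ∷ Γ ≋ just A ∷ Γ₁ ⊎ nothing ∷ Γ₂
  right : ∀ {A} {Γ Γ₁ Γ₂ : LinEnv Atom l} → Γ ≋ Γ₁ ⊎ Γ₂ →
          just A ∷ Γ ≋ nothing ∷ Γ₁ ⊎ just A ∷ Γ₂

infix 4 _︔_⊢_∶_

data _︔_⊢_∶_ {Atom : Set} {k l : ℕ} (Δ : UnrEnv Atom k) :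
  LinEnv Atom l → LTerm k l → Formula Atom → Set where

  lin     : ∀ {a A} →
            Δ ︔ ∅ [ a ]≔ just A ⊢ lin a ∶ A

  unr     : ∀ {u A} →
            Δ [ u ]= A →
            Δ ︔ ∅ ⊢ unr u ∶ A

  ⊗-intro : ∀ {Γ Γ₁ Γ₂ t s A B} →
            Γ ≋ Γ₁ ⊎ Γ₂ →
            Δ ︔ Γ₁ ⊢ t ∶ A →
            Δ ︔ Γ₂ ⊢ s ∶ B →
            Δ ︔ Γ ⊢ ⟨ t , s ⟩ ∶ A ⊗ B

  ⊗-elim  : ∀ {Γ Γ₁ Γ₂ t s A B C} →
            Γ ≋ Γ₁ ⊎ Γ₂ →
            Δ ︔ Γ₁ ⊢ s ∶ A ⊗ B →
            Δ ︔ just A ∷ just B ∷ Γ₂ ⊢ t ∶ C →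
            Δ ︔ Γ ⊢ t [⟨,⟩≔ s ] ∶ C

  ⅋-intro : ∀ {Γ t A B} →
            Δ ︔ just A ∷ just B ∷ Γ ⊢ t ∶ ⊥ →
            Δ ︔ Γ ⊢ ⅋· t ∶ A ^⊥ ⅋ B ^⊥

  ⅋-elimʳ : ∀ {Γ Γ₁ Γ₂ t s A B} →
            Γ ≋ Γ₁ ⊎ Γ₂ →
            Δ ︔ Γ₁ ⊢ t ∶ A ⅋ B →
            Δ ︔ Γ₂ ⊢ s ∶ A ^⊥ →
            Δ ︔ Γ ⊢ t ∙ s ∶ B

  ⅋-elimˡ : ∀ {Γ Γ₁ Γ₂ t s A B} →
            Γ ≋ Γ₁ ⊎ Γ₂ →
            Δ ︔ Γ₁ ⊢ t ∶ A ⅋ B →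
            Δ ︔ Γ₂ ⊢ s ∶ B ^⊥ →
            Δ ︔ Γ ⊢ t ▾ s ∶ A

  !-intro : ∀ {t A} →
            Δ ︔ just A ∷ ∅ ⊢ t ∶ ⊥ →
            Δ ︔ ∅ ⊢ !· t ∶ ! (A ^⊥)

  !-elim  : ∀ {Γ Γ₁ Γ₂ t s A B} →
            Γ ≋ Γ₁ ⊎ Γ₂ →
            Δ ︔ Γ₁ ⊢ s ∶ ! A →
            A ∷ Δ ︔ Γ₂ ⊢ t ∶ B →
            Δ ︔ Γ ⊢ t [!≔ s ] ∶ B

  ⁇-intro : ∀ {Γ t A} →
            A ^⊥ ∷ Δ ︔ Γ ⊢ t ∶ ⊥ →
            Δ ︔ Γ ⊢ ⁇· t ∶ ⁇ A

  ⁇-elim  : ∀ {Γ t s A} →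
            Δ ︔ Γ ⊢ s ∶ ⁇ A →
            Δ ︔ just A ∷ ∅ ⊢ t ∶ ⊥ →
            Δ ︔ Γ ⊢ t ▸ s ∶ ⊥

  contra  : ∀ {Γ Γ₁ Γ₂ t s B} →
            Γ ≋ Γ₁ ⊎ Γ₂ →
            Δ ︔ Γ₁ ⊢ t ∶ B →
            Δ ︔ Γ₂ ⊢ s ∶ B ^⊥ →
            Δ ︔ Γ ⊢ t ♯ s ∶ ⊥

  𝟙-intro : Δ ︔ ∅ ⊢ ⋆ ∶ 𝟙

  𝟙-elim  : ∀ {Γ Γ₁ Γ₂ t s A} →
            Γ ≋ Γ₁ ⊎ Γ₂ →
            Δ ︔ Γ₁ ⊢ s ∶ 𝟙 →
            Δ ︔ Γ₂ ⊢ t ∶ A →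
            Δ ︔ Γ ⊢ t [⋆≔ s ] ∶ A

infix 10 _ᵀ

_ᵀ : Type Atom → Formula Atom
(atom α) ᵀ = atom α
(A ⊃ B)  ᵀ = ⁇ (! ((A ᵀ) ^⊥)) ⅋ ⁇ (B ᵀ)

-- The abbreviation !t = !a.(t ♯ a); renaming along suc makes a fresh for t.

!ᵗ_ : LTerm k l → LTerm k l
!ᵗ t = !· (rename (λ u → u) suc t ♯ lin zero)

-- ρ and σ say which unrestricted variables represent the variables and the
-- co-variables in scope.  Composing them with suc accounts for a newly bound
-- unrestricted variable; for a λ these are first u and then x.

mutual
  ⟦_⟧ᵗ : Term m n → (Fin m → Fin k) → (Fin n → Fin k) → LTerm k l
  ⟦ var x ⟧ᵗ ρ σ = unr (ρ x)
  ⟦ μ· c ⟧ᵗ  ρ σ = ⁇· ⟦ c ⟧ᶜ (suc ∘′ ρ) (zero ∷ᶠ suc ∘′ σ)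
  ⟦ ƛ· v ⟧ᵗ  ρ σ =
    ⁇· (unr zero ♯
        (⅋· ((⟦ v ⟧ᵗ (zero ∷ᶠ suc ∘′ suc ∘′ ρ) (suc ∘′ suc ∘′ σ) ♯ lin (suc zero)) [!≔ lin zero ])))

  ⟦_⟧ᵉ : Coterm m n → (Fin m → Fin k) → (Fin n → Fin k) → LTerm k l
  ⟦ covar γ ⟧ᵉ ρ σ = !ᵗ unr (σ γ)
  ⟦ v · e ⟧ᵉ   ρ σ = !ᵗ ⟨ !ᵗ ⟦ v ⟧ᵗ ρ σ , ⟦ e ⟧ᵉ ρ σ ⟩

  ⟦_⟧ᶜ : Command m n → (Fin m → Fin k) → (Fin n → Fin k) → LTerm k l
  ⟦ ⟨ v ∣ e ⟩ ⟧ᶜ ρ σ = ⟦ v ⟧ᵗ ρ σ ♯ ⟦ e ⟧ᵉ ρ σ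

-- The m variables come first among the m + n unrestricted variables, followed
-- by the n co-variables, matching the concatenated environment ⁇ᵀ Γ ++ ⊥ᵀ Θ.

infix 10 _ᵀᵗ _ᵀᵉ _ᵀᶜ

_ᵀᵗ : Term m n → LTerm (m + n) l
_ᵀᵗ {m} {n} v = ⟦ v ⟧ᵗ (_↑ˡ n) (m ↑ʳ_)

_ᵀᵉ : Coterm m n → LTerm (m + n) l
_ᵀᵉ {m} {n} e = ⟦ e ⟧ᵉ (_↑ˡ n) (m ↑ʳ_)

_ᵀᶜ : Command m n → LTerm (m + n) l
_ᵀᶜ {m} {n} c = ⟦ c ⟧ᶜ (_↑ˡ n) (m ↑ʳ_)

infix 10 ⁇ᵀ_ ⊥ᵀ_

⁇ᵀ_ : Vec (Type Atom) m → UnrEnv Atom m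
⁇ᵀ_ = map (λ B → ⁇ (B ᵀ))

⊥ᵀ_ : Vec (Type Atom) n → UnrEnv Atom n
⊥ᵀ_ = map (λ B → (B ᵀ) ^⊥)

{-# OPTIONS --safe #-}
-- Simultaneous induction on derivations, for arbitrary assignments ρ, σ of
-- unrestricted variables compatible with the environments. A translated expression
-- has no free linear variables, so linear environments are empty except below the
-- binders of !t and λ. Weakening by a linear variable, needed since !t places t
-- below a binder, is an instance of closure under thinning.
module Submission where

open import Defs
open import Data.Fin.Base using (Fin; zero; suc; lift; _↑ˡ_; _↑ʳ_)
open import Data.Maybe.Base using (nothing; just)
open import Data.Nat.Base using (ℕ; zero; suc; _+_)
open import Data.Product.Base using (_×_; _,_)
open import Data.Vec.Base
  using (Vec; []; _∷_; _++_; here; there; _[_]=_; _[_]≔_)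
open import Data.Vec.Functional using () renaming (_∷_ to _∷ᶠ_)
open import Data.Vec.Properties using ([]=⇒lookup; lookup⇒[]=; lookup-map; lookup-++ˡ; lookup-++ʳ)
open import Function.Base using (_∘′_)
open import Relation.Binary.PropositionalEquality
  using (_≡_; refl; sym; cong; cong₂; subst; trans)

private variable
  Atom : Set
  k k′ l l′ m n : ℕ

^⊥-involutive : (A : Formula Atom) → A ^⊥ ^⊥ ≡ A
^⊥-involutive (atom α)   = refl
^⊥-involutive (coatom α) = refl
^⊥-involutive (A ⊗ B)    = cong₂ _⊗_ (^⊥-involutive A) (^⊥-involutive B)
^⊥-involutive (A ⅋ B)    = cong₂ _⅋_ (^⊥-involutive A) (^⊥-involutive B)
^⊥-involutive 𝟙          = refl
^⊥-involutive ⊥          = refl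
^⊥-involutive (! A)      = cong !_ (^⊥-involutive A)
^⊥-involutive (⁇ A)      = cong ⁇_ (^⊥-involutive A)

∅-split : ∀ l → ∅ {Atom} {l} ≋ ∅ ⊎ ∅
∅-split zero    = []
∅-split (suc l) = skip (∅-split l)

-- A constructor for lifting by k, rather than by one, makes rename commute with
-- thinnings definitionally: lift 2 is not definitionally lift 1 ∘ lift 1.

data Thinning : ℕ → ℕ → Set where
  weaken : Thinning l (suc l)
  keep   : ∀ k → Thinning l l′ → Thinning (k + l) (k + l′)

thinVar : Thinning l l′ → Fin l → Fin l′
thinVar weaken     = suc
thinVar (keep k θ) = lift k (thinVar θ)

thinEnv : Thinning l l′ → LinEnv Atom l → LinEnv Atom l′
thinEnv weaken           Γ       = nothing ∷ Γ
thinEnv (keep zero θ)    Γ       = thinEnv θ Γ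
thinEnv (keep (suc k) θ) (A ∷ Γ) = A ∷ thinEnv (keep k θ) Γ

thinEnv-∅ : (θ : Thinning l l′) → thinEnv θ (∅ {Atom}) ≡ ∅
thinEnv-∅ weaken           = refl
thinEnv-∅ (keep zero θ)    = thinEnv-∅ θ
thinEnv-∅ (keep (suc k) θ) = cong (nothing ∷_) (thinEnv-∅ (keep k θ))

thinEnv-singleton : (θ : Thinning l l′) (a : Fin l) {A : Formula Atom} →
  thinEnv θ (∅ [ a ]≔ just A) ≡ ∅ [ thinVar θ a ]≔ just A
thinEnv-singleton weaken           a       = refl
thinEnv-singleton (keep zero θ)    a       = thinEnv-singleton θ a
thinEnv-singleton (keep (suc k) θ) zero    = cong (just _ ∷_) (thinEnv-∅ (keep k θ))
thinEnv-singleton (keep (suc k) θ) (suc a) = cong (nothing ∷_) (thinEnv-singleton (keep k θ) a)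

thinEnv-split : (θ : Thinning l l′) {Γ Γ₁ Γ₂ : LinEnv Atom l} →
  Γ ≋ Γ₁ ⊎ Γ₂ → thinEnv θ Γ ≋ thinEnv θ Γ₁ ⊎ thinEnv θ Γ₂
thinEnv-split weaken           p         = skip p
thinEnv-split (keep zero θ)    p         = thinEnv-split θ p
thinEnv-split (keep (suc k) θ) (skip p)  = skip (thinEnv-split (keep k θ) p)
thinEnv-split (keep (suc k) θ) (left p)  = left (thinEnv-split (keep k θ) p)
thinEnv-split (keep (suc k) θ) (right p) = right (thinEnv-split (keep k θ) p)

infix 4 _⊆[_]_

_⊆[_]_ : UnrEnv Atom k → (Fin k → Fin k′) → UnrEnv Atom k′ → Set
Δ ⊆[ ρ ] Δ′ = ∀ {u A} → Δ [ u ]= A → Δ′ [ ρ u ]= A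

⊆-lift : {Δ : UnrEnv Atom k} {Δ′ : UnrEnv Atom k′} {ρ : Fin k → Fin k′} {B : Formula Atom} →
  Δ ⊆[ ρ ] Δ′ → B ∷ Δ ⊆[ lift 1 ρ ] B ∷ Δ′
⊆-lift i here      = here
⊆-lift i (there p) = there (i p)

-- Linear binders extend `θ` by `keep`. Only the identity is needed as `ρ` later, but under an
-- unrestricted binder it becomes `lift 1 ρ`, which is not definitionally the identity; hence the
-- generality.
rename-typed : {Δ : UnrEnv Atom k} {Δ′ : UnrEnv Atom k′} {ρ : Fin k → Fin k′}
  (θ : Thinning l l′) {Γ : LinEnv Atom l} {t : LTerm k l} {A : Formula Atom} →
  Δ ⊆[ ρ ] Δ′ → Δ ︔ Γ ⊢ t ∶ A → Δ′ ︔ thinEnv θ Γ ⊢ rename ρ (thinVar θ) t ∶ A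
rename-typed θ i (lin {a = a} {A}) rewrite thinEnv-singleton θ a {A} = lin
rename-typed {Atom} θ i (unr p) rewrite thinEnv-∅ {Atom = Atom} θ = unr (i p)
rename-typed θ i (⊗-intro p d e) =
  ⊗-intro (thinEnv-split θ p) (rename-typed θ i d) (rename-typed θ i e)
rename-typed θ i (⊗-elim p d e) =
  ⊗-elim (thinEnv-split θ p) (rename-typed θ i d) (rename-typed (keep 2 θ) i e)
rename-typed θ i (⅋-intro d) = ⅋-intro (rename-typed (keep 2 θ) i d)
rename-typed θ i (⅋-elimʳ p d e) =
  ⅋-elimʳ (thinEnv-split θ p) (rename-typed θ i d) (rename-typed θ i e)
rename-typed θ i (⅋-elimˡ p d e) =
  ⅋-elimˡ (thinEnv-split θ p) (rename-typed θ i d) (rename-typed θ i e)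
rename-typed {Atom} θ i (!-intro {A = A} d)
  -- The recursive call precedes the rewrite, so that `thinEnv θ ∅` in its type also becomes `∅`, as
  -- `!-intro` demands.
  with d′ ← rename-typed (keep 1 θ) i d
  rewrite thinEnv-∅ {Atom = Atom} θ = !-intro d′
rename-typed θ i (!-elim p d e) =
  !-elim (thinEnv-split θ p) (rename-typed θ i d) (rename-typed θ (⊆-lift i) e)
rename-typed θ i (⁇-intro d) = ⁇-intro (rename-typed θ (⊆-lift i) d)
rename-typed θ i (⁇-elim {A = A} d e) =
  ⁇-elim (rename-typed θ i d)
    (subst (λ Γ → _ ︔ just A ∷ Γ ⊢ _ ∶ ⊥) (thinEnv-∅ θ) (rename-typed (keep 1 θ) i e))
rename-typed θ i (contra p d e) =
  contra (thinEnv-split θ p) (rename-typed θ i d) (rename-typed θ i e)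
rename-typed {Atom} θ i 𝟙-intro rewrite thinEnv-∅ {Atom = Atom} θ = 𝟙-intro
rename-typed θ i (𝟙-elim p d e) =
  𝟙-elim (thinEnv-split θ p) (rename-typed θ i d) (rename-typed θ i e)

-- The fresh `a` gets type `A ^⊥`, so `!-intro` yields `! (A ^⊥ ^⊥)`. It applies because `t` uses no
-- linear variable.
!ᵗ-typed : {Δ : UnrEnv Atom k} {t : LTerm k l} {A : Formula Atom} →
  Δ ︔ ∅ ⊢ t ∶ A → Δ ︔ ∅ ⊢ !ᵗ t ∶ ! A
!ᵗ-typed {l = l} {A = A} d =
  subst (λ B → _ ︔ ∅ ⊢ _ ∶ ! B) (^⊥-involutive A)
    (!-intro (contra (right (∅-split l)) (rename-typed weaken (λ p → p) d) lin))

-- Insensitive to the order of `Δ`: binders interleave variables and co-variables, so a concatenated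
-- form would not survive the induction.
Represents : (Type Atom → Formula Atom) → Vec (Type Atom) m → (Fin m → Fin k) → UnrEnv Atom k → Set
Represents F Γ ρ Δ = ∀ {x A} → Γ [ x ]= A → Δ [ ρ x ]= F A

Represents-∷ : {F : Type Atom → Formula Atom} {Γ : Vec (Type Atom) m} {ρ : Fin m → Fin k}
  {Δ : UnrEnv Atom k} {A : Type Atom} →
  Represents F Γ ρ Δ → Represents F (A ∷ Γ) (zero ∷ᶠ suc ∘′ ρ) (F A ∷ Δ)
Represents-∷ r here      = here
Represents-∷ r (there p) = there (r p)

varFormula covarFormula : Type Atom → Formula Atom
varFormula A   = ⁇ (A ᵀ)
covarFormula A = (A ᵀ) ^⊥

module _ {Atom : Set} where mutual

  ⟦⟧ᵗ-typed : {Γ : Vec (Type Atom) m} {Θ : Vec (Type Atom) n} {Δ : UnrEnv Atom k}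
    {ρ : Fin m → Fin k} {σ : Fin n → Fin k} {v : Term m n} {A : Type Atom} →
    Represents varFormula Γ ρ Δ → Represents covarFormula Θ σ Δ →
    Γ ⊢ v ∶ A ∣ Θ → Δ ︔ ∅ {l = l} ⊢ ⟦ v ⟧ᵗ ρ σ ∶ ⁇ (A ᵀ)
  ⟦⟧ᵗ-typed r s (var p) = unr (r p)
  -- `⁇-intro` gives `γ` the negated type, which is exactly `covarFormula`.
  ⟦⟧ᵗ-typed r s (mu c) = ⁇-intro (⟦⟧ᶜ-typed (λ p → there (r p)) (Represents-∷ s) c)
  ⟦⟧ᵗ-typed {l = l} {Δ = Δ} r s (lam {A = A} {B} v) =
    ⁇-intro (contra (∅-split l) (unr here)
      -- Against `u`, a double negation of `(A ⊃ B) ᵀ` is required. Its right half is what `⅋-intro`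
      -- yields; its left half differs by one double negation.
      (subst (λ C → ((A ⊃ B) ᵀ) ^⊥ ∷ Δ ︔ ∅ ⊢ _ ∶ ⁇ ! C ⅋ ⁇ ((B ᵀ) ^⊥ ^⊥)) (sym (^⊥-involutive ((A ᵀ) ^⊥)))
        (⅋-intro {A = ! ⁇ (A ᵀ)} {B = ! ((B ᵀ) ^⊥)}
          -- `a` is spent here to bind `x` at `⁇ (A ᵀ)`; `b` is left to face the body, whose type
          -- `⁇ (B ᵀ)` is dual to that of `b`.
          (!-elim (left (right (∅-split l))) lin
            (contra (skip (right (∅-split l)))
              (⟦⟧ᵗ-typed (Represents-∷ (λ p → there (r p))) (λ p → there (there (s p))) v)
              lin)))))

  ⟦⟧ᵉ-typed : {Γ : Vec (Type Atom) m} {Θ : Vec (Type Atom) n} {Δ : UnrEnv Atom k}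
    {ρ : Fin m → Fin k} {σ : Fin n → Fin k} {e : Coterm m n} {A : Type Atom} →
    Represents varFormula Γ ρ Δ → Represents covarFormula Θ σ Δ →
    Γ ∣ e ∶ A ⊢ Θ → Δ ︔ ∅ {l = l} ⊢ ⟦ e ⟧ᵉ ρ σ ∶ ! ((A ᵀ) ^⊥)
  ⟦⟧ᵉ-typed r s (covar p) = !ᵗ-typed (unr (s p))
  ⟦⟧ᵉ-typed {l = l} r s (app {A = A} v e) =
    !ᵗ-typed (⊗-intro (∅-split l)
      -- Negating the left part `⁇ ! ((A ᵀ) ^⊥)` of the arrow leaves a double negation on `A ᵀ`.
      (subst (λ C → _ ︔ ∅ ⊢ _ ∶ ! ⁇ C) (sym (^⊥-involutive (A ᵀ))) (!ᵗ-typed (⟦⟧ᵗ-typed r s v)))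
      (⟦⟧ᵉ-typed r s e))

  ⟦⟧ᶜ-typed : {Γ : Vec (Type Atom) m} {Θ : Vec (Type Atom) n} {Δ : UnrEnv Atom k}
    {ρ : Fin m → Fin k} {σ : Fin n → Fin k} {c : Command m n} →
    Represents varFormula Γ ρ Δ → Represents covarFormula Θ σ Δ →
    c ∶⟨ Γ ⊢ Θ ⟩ → Δ ︔ ∅ {l = l} ⊢ ⟦ c ⟧ᶜ ρ σ ∶ ⊥
  ⟦⟧ᶜ-typed {l = l} r s (cut v e) =
    -- The two types are dual by computation alone.
    contra (∅-split l) (⟦⟧ᵗ-typed r s v) (⟦⟧ᵉ-typed r s e)

lemma24 : {Atom : Set} {m n l : ℕ} (Γ : Vec (Type Atom) m) (Θ : Vec (Type Atom) n) →
    ((c : Command m n) → c ∶⟨ Γ ⊢ Θ ⟩ →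
    (⁇ᵀ Γ ++ ⊥ᵀ Θ) ︔ ∅ {l = l} ⊢ c ᵀᶜ ∶ ⊥)
    × ((e : Coterm m n) (A : Type Atom) → Γ ∣ e ∶ A ⊢ Θ →
    (⁇ᵀ Γ ++ ⊥ᵀ Θ) ︔ ∅ {l = l} ⊢ e ᵀᵉ ∶ ! ((A ᵀ) ^⊥))
    × ((v : Term m n) (A : Type Atom) → Γ ⊢ v ∶ A ∣ Θ →
    (⁇ᵀ Γ ++ ⊥ᵀ Θ) ︔ ∅ {l = l} ⊢ v ᵀᵗ ∶ ⁇ (A ᵀ))
lemma24 Γ Θ =
    (λ c d → ⟦⟧ᶜ-typed vars covars d)
  , (λ e A d → ⟦⟧ᵉ-typed vars covars d)
  , (λ v A d → ⟦⟧ᵗ-typed vars covars d)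
  where
  vars : Represents varFormula Γ (_↑ˡ _) (⁇ᵀ Γ ++ ⊥ᵀ Θ)
  vars {x} p = lookup⇒[]= _ _ (trans (lookup-++ˡ (⁇ᵀ Γ) (⊥ᵀ Θ) x)
    (trans (lookup-map x varFormula Γ) (cong varFormula ([]=⇒lookup p))))

  covars : Represents covarFormula Θ (_ ↑ʳ_) (⁇ᵀ Γ ++ ⊥ᵀ Θ)
  covars {γ} p = lookup⇒[]= _ _ (trans (lookup-++ʳ (⁇ᵀ Γ) (⊥ᵀ Θ) γ)
    (trans (lookup-map γ covarFormula Θ) (cong covarFormula ([]=⇒lookup p))))
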